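{- Let $G$ be an $n$-vertex triangle-free graph. If $G$ contains at least $k$ vertex-disjoint $P_3$'s, then $$\mathrm{MIS}(G)\le 2^{\frac{n}{2}-\frac{k}{25}}.$$
   Context: Graphs are finite and simple. $P_3$ denotes the path on $3$ vertices; "contains $k$ vertex-disjoint $P_3$'s" means that $G$ has $k$ pairwise vertex-disjoint subgraphs isomorphic to $P_3$ ($k$ a non-negative integer). $\mathrm{MIS}(G)$ denotes the number of maximal (under inclusion) independent sets of $G$. -}

module Defs where

open import Data.Fin using (Fin; toℕ)
open import Data.Fin.Properties using (all?)
open import Data.Fin.Subset using (Subset; inside; outside; _∈_; _⊆_)
open import Data.Fin.Subset.Properties using (_∈?_; _⊆?_; anySubset?)
open import Data.Integer using (+_; -[1+_])
open import Data.List using (List; []; _∷_; _++_; map; filter; length)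
open import Data.Nat using (ℕ; zero; suc; _*_; _^_; _≤_)
open import Data.Nat.Properties using (_≟_; 1+n≢n)
open import Data.Product using (Σ; _×_; _,_)
open import Data.Rational.Unnormalised using (ℚᵘ; mkℚᵘ)
open import Data.Sum using (_⊎_; inj₁; inj₂; swap)
open import Data.Vec using ([]; _∷_)
open import Function.Definitions using (Injective)
open import Level using (0ℓ)
open import Relation.Binary.Core using (Rel)
open import Relation.Binary.Definitions using (Decidable; Symmetric)
open import Relation.Binary.PropositionalEquality using (_≡_; _≢_; sym)
open import Relation.Nullary using (Dec; ¬_; ¬?)
open import Relation.Nullary.Decidable
  using (map′; _→-dec_; _×-dec_; _⊎-dec_; decidable-stable)

-- Adjacency is required to be decidable, as it always is classically; this is
-- what makes counting independent sets meaningful constructively.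
record Graph (n : ℕ) : Set₁ where
  field
    Adj      : Rel (Fin n) 0ℓ
    adj?     : Decidable Adj
    adj-sym  : Symmetric Adj
    adj-irr  : ∀ {v} → ¬ Adj v v

open Graph public

TriangleFree : ∀ {n} → Graph n → Set
TriangleFree G = ∀ {u v w} → Adj G u v → Adj G v w → ¬ Adj G u w

Path : (m : ℕ) → Graph m
Path m = record
  { Adj     = λ i j → toℕ j ≡ suc (toℕ i) ⊎ toℕ i ≡ suc (toℕ j)
  ; adj?    = λ i j → (toℕ j ≟ suc (toℕ i)) ⊎-dec (toℕ i ≟ suc (toℕ j))
  ; adj-sym = swap
  ; adj-irr = λ { (inj₁ e) → 1+n≢n (sym e) ; (inj₂ e) → 1+n≢n (sym e) }
  }

P₃ : Graph 3
P₃ = Path 3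

-- A (not necessarily induced) subgraph of G isomorphic to H, presented by the
-- embedding of H onto it.
record Copy {m n} (H : Graph m) (G : Graph n) : Set where
  field
    to        : Fin m → Fin n
    injective : Injective _≡_ _≡_ to
    preserves : ∀ {a b} → Adj H a b → Adj G (to a) (to b)

open Copy public

VertexDisjoint : ∀ {m n} {H : Graph m} {G : Graph n} → Copy H G → Copy H G → Set
VertexDisjoint c d = ∀ a b → to c a ≢ to d b

ContainsDisjoint : ∀ {m n} → ℕ → Graph m → Graph n → Set
ContainsDisjoint k H G =
  Σ (Fin k → Copy H G) λ c → ∀ i j → i ≢ j → VertexDisjoint (c i) (c j)

Independent : ∀ {n} → Graph n → Subset n → Set
Independent G S = ∀ u v → u ∈ S → v ∈ S → ¬ Adj G u v

MaximalIndependent : ∀ {n} → Graph n → Subset n → Set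
MaximalIndependent G S =
  Independent G S × (∀ T → Independent G T → S ⊆ T → T ⊆ S)

allSubset? : ∀ {n} {P : Subset n → Set} → (∀ S → Dec (P S)) → Dec (∀ S → P S)
allSubset? P? = map′
  (λ ¬∃¬ S → decidable-stable (P? S) (λ ¬p → ¬∃¬ (S , ¬p)))
  (λ ∀P (S , ¬p) → ¬p (∀P S))
  (¬? (anySubset? (λ S → ¬? (P? S))))

independent? : ∀ {n} (G : Graph n) S → Dec (Independent G S)
independent? G S = all? λ u → all? λ v →
  (u ∈? S) →-dec ((v ∈? S) →-dec ¬? (adj? G u v))

maximalIndependent? : ∀ {n} (G : Graph n) S → Dec (MaximalIndependent G S)
maximalIndependent? G S = independent? G S ×-dec
  allSubset? (λ T → independent? G T →-dec ((S ⊆? T) →-dec (T ⊆? S)))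

-- Every subset of Fin n, each listed exactly once.
subsets : ∀ n → List (Subset n)
subsets zero    = [] ∷ []
subsets (suc n) = map (outside ∷_) (subsets n) ++ map (inside ∷_) (subsets n)

MIS : ∀ {n} → Graph n → ℕ
MIS {n} G = length (filter (maximalIndependent? G) (subsets n))

-- m ≤2^ q says m ≤ 2 ^ q for a rational exponent q. The real number 2 ^ (a / b)
-- is the positive b-th root of 2 ^ a, so for b ≥ 1 the inequality
-- m ≤ 2 ^ (a / b) means m ^ b ≤ 2 ^ a, where a negative power of 2 is moved to
-- the left-hand side. The truth value does not depend on the chosen
-- representative a / b. The second argument of mkℚᵘ is b - 1.
infix 4 _≤2^_

_≤2^_ : ℕ → ℚᵘ → Set
m ≤2^ mkℚᵘ (+ a)    b-1 = m ^ suc b-1 ≤ 2 ^ a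
m ≤2^ mkℚᵘ -[1+ a ] b-1 = m ^ suc b-1 * 2 ^ suc a ≤ 1

{-# OPTIONS --safe #-}
module Submission where

-- Branch on the maximal independent sets of G[U], for a shrinking vertex set U.
-- A deleted vertex destroys at most one P₃ of a packing, so it lowers the bound
-- 2 ^ (∣U∣ / 2 - k / 25) by a factor of at least 2 ^ (23/50).  Isolated vertices
-- and isolated edges meet no P₃ and gain the full 2 ^ (1/2) per vertex.  If the
-- minimum degree is at least 4, branching on one vertex pays off.  Otherwise, at a
-- vertex v of minimum degree, branching on which of v and its neighbours is the
-- first to lie in the set pays off except when v and both its neighbours have
-- degree 2.  Then let a and b be the vertices at distance 2 beyond the neighbours
-- w₁ and w₂: if a = b, then w₁ and w₂ are twins, otherwise a set avoiding v and w₁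
-- contains both w₂ and a, which deletes at least five vertices.

open import Data.Fin using (Fin; zero; suc)
open import Data.Fin.Properties using (_≟_; any?; suc-injective)
open import Data.Fin.Subset using (Subset; _∈_; _∉_; _⊆_; _∪_; ⁅_⁆; ∣_∣; ⊤) renaming (_-_ to _∖_)
open import Data.Fin.Subset.Properties
  using (_∈?_; nonempty?; ⊆-antisym; p⊆q⇒∣p∣≤∣q∣; p⊂q⇒∣p∣<∣q∣; p─q⊆p; x∈p∧x≢y⇒x∈p-y; p─x─y≡p─y─x;
         x∈p⇒∣p-x∣<∣p∣; p⊆p∪q; q⊆p∪q; x∈p∪q⁻; x∈⁅x⁆; x∈⁅y⁆⇒x≡y; ∈⊤; ∣⊤∣≡n)
open import Data.List using (List; []; _∷_; _++_; map; filter; length; foldl; allFin)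
open import Data.List.Membership.DecPropositional using () renaming (_∈?_ to ∈?-list)
open import Data.List.Membership.Propositional using (lose) renaming (_∈_ to _∈ˡ_; _∉_ to _∉ˡ_)
open import Data.List.Membership.Propositional.Properties
  using (∈-filter⁺; ∈-filter⁻; ∈-allFin; ∈-++⁺ʳ; ∈-++⁻; ∈-map⁻)
open import Data.List.Properties using (filter-accept; length-++)
open import Data.List.Relation.Unary.All as All using (All; []; _∷_)
import Data.List.Relation.Unary.All.Properties as AllP
open import Data.List.Relation.Unary.AllPairs using ([]; _∷_)
open import Data.List.Relation.Unary.Any as Any using (Any; here; there)
open import Data.List.Relation.Unary.Unique.Propositional using (Unique)
import Data.List.Relation.Unary.Unique.Propositional.Properties as Unique
open import Data.Nat using (ℕ; zero; suc; _+_; _*_; _∸_; _^_; _≤_; _<_; _≤?_; z≤n; s≤s; NonZero)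
open import Data.Nat.Induction using (<-wellFounded)
open import Data.Nat.ListAction using (sum)
open import Data.Nat.Properties hiding (_≟_; suc-injective)
open import Data.Nat.Tactic.RingSolver using (solve-∀)
open import Data.List.Extrema ≤-totalOrder using (argmin; argmin-all; f[argmin]≤f[xs])
open import Data.Product using (∃; _×_; _,_; proj₁; proj₂)
open import Data.Sum using (inj₁; inj₂; [_,_]′)
open import Data.Vec using ([]; _∷_; here; there)
open import Data.Vec.Properties using (∷-injectiveʳ)
open import Function using (case_of_)
open import Induction.WellFounded using (Acc; acc)
open import Relation.Binary.PropositionalEquality
open import Relation.Nullary using (Dec; ¬_; ¬?; yes; no; contradiction)
open import Relation.Nullary.Decidable using (_×-dec_)

open import Defs

-- Inequalities between powers, in place of real roots

^-distribʳ-* : ∀ e m n → (m * n) ^ e ≡ m ^ e * n ^ e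
^-distribʳ-* zero    m n = refl
^-distribʳ-* (suc e) m n = begin
  m * n * (m * n) ^ e       ≡⟨ cong (m * n *_) (^-distribʳ-* e m n) ⟩
  m * n * (m ^ e * n ^ e)   ≡⟨ [m*n]*[o*p]≡[m*o]*[n*p] m n (m ^ e) (n ^ e) ⟩
  m * m ^ e * (n * n ^ e)   ∎
  where open ≡-Reasoning

^-cancelˡ-< : ∀ e {m n} → m ^ e < n ^ e → m < n
^-cancelˡ-< e m^e<n^e = ≰⇒> λ n≤m → <⇒≱ m^e<n^e (^-monoˡ-≤ e n≤m)

-- For r = (F / K) ^ (1 / e) this is m ≤ r / W ^ (1 / e) ≤ (p / q) r < (p / q) M, raised to the
-- power `e` and cleared of denominators.
share-< : ∀ e q p .{{_ : NonZero p}} W {m M K F} → q ^ e ≤ p ^ e * W → m ^ e * (K * W) ≤ F →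
          F < M ^ e * K → q * m < p * M
share-< e q p W {m} {M} {K} {F} rate small large = ^-cancelˡ-< e (*-cancelʳ-< K _ _ (begin-strict
  (q * m) ^ e * K           ≡⟨ cong (_* K) (^-distribʳ-* e q m) ⟩
  q ^ e * m ^ e * K         ≤⟨ *-monoˡ-≤ K (*-monoˡ-≤ (m ^ e) rate) ⟩
  p ^ e * W * m ^ e * K     ≡⟨ reorder (p ^ e) W (m ^ e) K ⟩
  p ^ e * (m ^ e * (K * W)) ≤⟨ *-monoʳ-≤ (p ^ e) small ⟩
  p ^ e * F                 <⟨ *-monoʳ-< (p ^ e) {{m^n≢0 p e}} large ⟩
  p ^ e * (M ^ e * K)       ≡⟨ *-assoc (p ^ e) (M ^ e) K ⟨
  p ^ e * M ^ e * K         ≡⟨ cong (_* K) (^-distribʳ-* e p M) ⟨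
  (p * M) ^ e * K           ∎))
  where
  open ≤-Reasoning
  reorder : ∀ a b c d → a * b * c * d ≡ a * (c * (d * b))
  reorder = solve-∀

module _ {B : Set} where

  sum-map-< : ∀ {f g : B → ℕ} {bs} → (∀ b → f b ≤ g b) → Any (λ b → f b < g b) bs →
              sum (map f bs) < sum (map g bs)
  sum-map-< {f} {g} {_ ∷ bs} f≤g (here lt) = +-mono-<-≤ lt (pointwise bs)
    where
    pointwise : ∀ bs → sum (map f bs) ≤ sum (map g bs)
    pointwise []       = z≤n
    pointwise (b ∷ bs) = +-mono-≤ (f≤g b) (pointwise bs)
  sum-map-< f≤g (there lts) = +-mono-≤-< (f≤g _) (sum-map-< f≤g lts)

  -- Each strict inequality leaves a surplus of 1. Collected as `length bs`, these keep the sum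
  -- strict whenever `bs` is nonempty.
  scaled-sum : ∀ q M {f g : B → ℕ} {bs} → All (λ b → q * f b < g b * M) bs →
               q * sum (map f bs) + length bs ≤ sum (map g bs) * M
  scaled-sum q M [] = ≤-reflexive (trans (+-identityʳ _) (*-zeroʳ q))
  scaled-sum q M {f} {g} {b ∷ bs} (lt ∷ lts) = begin
    q * (f b + sum (map f bs)) + suc (length bs)
      ≡⟨ reorder q (f b) (sum (map f bs)) (length bs) ⟩
    suc (q * f b) + (q * sum (map f bs) + length bs)
      ≤⟨ +-mono-≤ lt (scaled-sum q M lts) ⟩
    g b * M + sum (map g bs) * M
      ≡⟨ *-distribʳ-+ M (g b) (sum (map g bs)) ⟨
    (g b + sum (map g bs)) * M ∎
    where
    open ≤-Reasoning
    reorder : ∀ q a s l → q * (a + s) + suc l ≡ suc (q * a) + (q * s + l)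
    reorder = solve-∀

  -- With r the real root (F / K) ^ (1 / e), the hypotheses say f b ≤ (g b / q) * r,
  -- and they sum up to M ≤ r.  Avoiding roots, we assume M > r instead.
  root-sum-≤ : ∀ e q .{{_ : NonZero e}} {M K F} {f g w : B → ℕ} bs → (∀ b → NonZero (g b)) →
               (∀ b → q ^ e ≤ g b ^ e * w b) → All (λ b → f b ^ e * (K * w b) ≤ F) bs →
               M ≤ sum (map f bs) → sum (map g bs) ≤ q → M ^ e * K ≤ F
  -- Without terms M = 0, and a nonzero exponent makes its power vanish.
  root-sum-≤ (suc e) q [] g≢0 rate [] z≤n ≤q = z≤n
  root-sum-≤ e q {M} {K} {F} {f} {g} {w} bs@(b ∷ bs′) g≢0 rate small M≤ ≤q = ≮⇒≥ λ large →
    n≮n (q * M) (begin-strict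
      q * M                           ≤⟨ *-monoʳ-≤ q M≤ ⟩
      q * sum (map f bs)              <⟨ m<m+n _ (s≤s z≤n) ⟩
      q * sum (map f bs) + length bs  ≤⟨ scaled-sum q M {f} {g} (All.map (λ {c} s →
                                           share-< e q (g c) {{g≢0 c}} (w c) {f c} {M} {K} {F} (rate c) s large) small) ⟩
      sum (map g bs) * M              ≤⟨ *-monoˡ-≤ M ≤q ⟩
      q * M                           ∎)
    where open ≤-Reasoning

module _ {A : Set} {B : Set} {P : B → A → Set} (P? : ∀ b a → Dec (P b a)) where

  -- Every element is counted for at least one `b`. Multiple counting only enlarges the sum, so
  -- branches may overlap.
  length-cover : ∀ {bs} xs → All (λ a → Any (λ b → P b a) bs) xs →
                 length xs ≤ sum (map (λ b → length (filter (P? b) xs)) bs)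
  length-cover []       []             = z≤n
  length-cover (a ∷ xs) (covered ∷ cs) =
    ≤-<-trans (length-cover xs cs) (sum-map-< grows (Any.map accepts covered))
    where
    accepts : ∀ {b} → P b a → length (filter (P? b) xs) < length (filter (P? b) (a ∷ xs))
    accepts {b} p = ≤-reflexive (sym (cong length (filter-accept (P? b) p)))

    grows : ∀ b → length (filter (P? b) xs) ≤ length (filter (P? b) (a ∷ xs))
    grows b with P? b a
    ... | yes _ = n≤1+n _
    ... | no _  = ≤-refl

-- Brings the induction hypothesis for a residue into the shape asked for by `root-sum-≤`: `w` and
-- `u` are 25 times the new and old vertex counts, `l` and `k` twice the new and old packing sizes,
-- `g` the gain.
transfer : ∀ e m w g k u l → m ^ e * 2 ^ l ≤ 2 ^ w → w + g + k ≤ u + l → m ^ e * (2 ^ k * 2 ^ g) ≤ 2 ^ u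
transfer e m w g k u l small le = *-cancelʳ-≤ _ _ (2 ^ l) {{m^n≢0 2 l}} (begin
  m ^ e * (2 ^ k * 2 ^ g) * 2 ^ l   ≡⟨ reorder (m ^ e) (2 ^ k) (2 ^ g) (2 ^ l) ⟩
  m ^ e * 2 ^ l * 2 ^ g * 2 ^ k     ≤⟨ *-monoˡ-≤ (2 ^ k) (*-monoˡ-≤ (2 ^ g) small) ⟩
  2 ^ w * 2 ^ g * 2 ^ k             ≡⟨ cong (_* 2 ^ k) (^-distribˡ-+-* 2 w g) ⟨
  2 ^ (w + g) * 2 ^ k               ≡⟨ ^-distribˡ-+-* 2 (w + g) k ⟨
  2 ^ (w + g + k)                   ≤⟨ ^-monoʳ-≤ 2 le ⟩
  2 ^ (u + l)                       ≡⟨ ^-distribˡ-+-* 2 u l ⟩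
  2 ^ u * 2 ^ l                     ∎)
  where
  open ≤-Reasoning
  reorder : ∀ m k g l → m * (k * g) * l ≡ m * l * g * k
  reorder = solve-∀

-- Deleting vertices from a subset

private variable
  n : ℕ

x∉p-x : ∀ (p : Subset n) x → x ∉ p ∖ x
x∉p-x (_ ∷ p) (suc x) (there x∈) = x∉p-x p x x∈

x∈p-y⁻ : ∀ {p : Subset n} {x y} → x ∈ p ∖ y → x ∈ p × x ≢ y
x∈p-y⁻ {p = p} {y = y} x∈ = p─q⊆p p ⁅ y ⁆ x∈ , λ { refl → x∉p-x p y x∈ }

p-x⊆p : ∀ {p : Subset n} {x} → p ∖ x ⊆ p
p-x⊆p y∈ = proj₁ (x∈p-y⁻ y∈)

∖-mono : ∀ {p q : Subset n} {x} → p ⊆ q → p ∖ x ⊆ q ∖ x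
∖-mono p⊆q y∈ = let y∈p , y≢x = x∈p-y⁻ y∈ in x∈p∧x≢y⇒x∈p-y (p⊆q y∈p) y≢x

x∉p⇒p⊆p-x : ∀ {p : Subset n} {x} → x ∉ p → p ⊆ p ∖ x
x∉p⇒p⊆p-x x∉p y∈p = x∈p∧x≢y⇒x∈p-y y∈p λ { refl → x∉p y∈p }

infixl 5 _∖*_

_∖*_ : Subset n → List (Fin n) → Subset n
_∖*_ = foldl _∖_

∖*⁻ : ∀ {U : Subset n} {y} xs → y ∈ U ∖* xs → y ∈ U × y ∉ˡ xs
∖*⁻ []       y∈ = y∈ , λ ()
∖*⁻ (x ∷ xs) y∈ =
  let y∈U-x , y∉xs = ∖*⁻ xs y∈
      y∈U , y≢x    = x∈p-y⁻ y∈U-x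
  in y∈U , λ { (here y≡x) → y≢x y≡x ; (there y∈xs) → y∉xs y∈xs }

∖*⁺ : ∀ {U : Subset n} {y} xs → y ∈ U → y ∉ˡ xs → y ∈ U ∖* xs
∖*⁺ []       y∈U y∉xs = y∈U
∖*⁺ (x ∷ xs) y∈U y∉xs = ∖*⁺ xs (x∈p∧x≢y⇒x∈p-y y∈U (λ y≡x → y∉xs (here y≡x))) (λ y∈xs → y∉xs (there y∈xs))

-- Lets the vertices that count towards a gain be deleted first, whatever the order and repetitions
-- in the full list.
∖*-absorbˡ : ∀ {U : Subset n} {xs ys} → (∀ {y} → y ∈ˡ ys → y ∈ˡ xs) → U ∖* (ys ++ xs) ≡ U ∖* xs
∖*-absorbˡ {U = U} {xs} {ys} ys⊆xs = ⊆-antisym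
  (λ y∈ → let y∈U , y∉ = ∖*⁻ (ys ++ xs) y∈ in ∖*⁺ xs y∈U (λ y∈xs → y∉ (∈-++⁺ʳ ys y∈xs)))
  (λ y∈ → let y∈U , y∉xs = ∖*⁻ xs y∈ in
          ∖*⁺ (ys ++ xs) y∈U (λ y∈ → [ (λ y∈ys → y∉xs (ys⊆xs y∈ys)) , y∉xs ]′ (∈-++⁻ ys y∈)))

-- Prices of branches

-- 2 ^ (-23 r / 50) in percent, rounded up; larger r do not occur.
price : ℕ → ℕ
price 1 = 73
price 2 = 53
price 3 = 39
price 4 = 28
price 5 = 21
price 6 = 15
price _ = 100

-- This is price r / 100 ≥ 2 ^ (-23 r / 50) raised to the power 50, the common denominator of n / 2
-- and k / 25.
price-rate : ∀ r → NonZero (price r) × 100 ^ 50 ≤ price r ^ 50 * 2 ^ (23 * r)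
price-rate 0 = _ , ≤ᵇ⇒≤ _ _ _
price-rate 1 = _ , ≤ᵇ⇒≤ _ _ _
price-rate 2 = _ , ≤ᵇ⇒≤ _ _ _
price-rate 3 = _ , ≤ᵇ⇒≤ _ _ _
price-rate 4 = _ , ≤ᵇ⇒≤ _ _ _
price-rate 5 = _ , ≤ᵇ⇒≤ _ _ _
price-rate 6 = _ , ≤ᵇ⇒≤ _ _ _
-- The default price 100 is the trivial share 1.
price-rate r@(suc (suc (suc (suc (suc (suc (suc _))))))) = _ , m≤m*n (100 ^ 50) (2 ^ (23 * r)) {{m^n≢0 2 (23 * r)}}

subsets! : ∀ m → Unique (subsets m)
subsets! zero    = [] ∷ []
subsets! (suc m) = Unique.++⁺ (Unique.map⁺ ∷-injectiveʳ (subsets! m)) (Unique.map⁺ ∷-injectiveʳ (subsets! m))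
  λ (S∈₁ , S∈₂) → case (∈-map⁻ _ S∈₁ , ∈-map⁻ _ S∈₂) of λ { ((_ , _ , refl) , (_ , _ , ())) }

-- Packings of paths on three vertices

module Bound {n} (G : Graph n) where

  private variable
    k : ℕ
    U V W : Subset n
    a b c v x : Fin n

  record P₃In (U : Subset n) (a b c : Fin n) : Set where
    constructor p₃
    field
      a∈  : a ∈ U
      b∈  : b ∈ U
      c∈  : c ∈ U
      a~b : Adj G a b
      b~c : Adj G b c
      a≢c : a ≢ c

  -- Each path is deleted before the next is chosen, which builds disjointness into the index.
  data Packing : ℕ → Subset n → Set where
    none : Packing zero U
    add  : P₃In U a b c → Packing k (U ∖ a ∖ b ∖ c) → Packing (suc k) U

  P₃In-mono : U ⊆ V → P₃In U a b c → P₃In V a b c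
  P₃In-mono U⊆V (p₃ a∈ b∈ c∈ a~b b~c a≢c) = p₃ (U⊆V a∈) (U⊆V b∈) (U⊆V c∈) a~b b~c a≢c

  P₃In-avoid : P₃In U a b c → a ≢ x → b ≢ x → c ≢ x → P₃In (U ∖ x) a b c
  P₃In-avoid (p₃ a∈ b∈ c∈ a~b b~c a≢c) a≢x b≢x c≢x =
    p₃ (x∈p∧x≢y⇒x∈p-y a∈ a≢x) (x∈p∧x≢y⇒x∈p-y b∈ b≢x) (x∈p∧x≢y⇒x∈p-y c∈ c≢x) a~b b~c a≢c

  Packing-mono : U ⊆ V → Packing k U → Packing k V
  Packing-mono U⊆V none       = none
  Packing-mono U⊆V (add p ps) =
    add (P₃In-mono U⊆V p) (Packing-mono (∖-mono (∖-mono (∖-mono U⊆V))) ps)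

  delete-first : ∀ (U : Subset n) a b c x → U ∖ a ∖ b ∖ c ∖ x ≡ U ∖ x ∖ a ∖ b ∖ c
  delete-first U a b c x =
    trans (p─x─y≡p─y─x (U ∖ a ∖ b) c x)
    (cong (_∖ c) (trans (p─x─y≡p─y─x (U ∖ a) b x) (cong (_∖ b) (p─x─y≡p─y─x U a x))))

  -- If `x` lies on the first path, that path is given up and the others already avoid `x`.
  -- Otherwise it is kept and `x` is deleted from the rest.
  Packing-∖ : ∀ x → Packing k U → Packing (k ∸ 1) (U ∖ x)
  Packing-∖ x none = none
  Packing-∖ {U = U} x (add {a = a} {b} {c} p ps) with a ≟ x | b ≟ x | c ≟ x
  ... | yes refl | _        | _        = Packing-mono (λ y∈ → p-x⊆p (p-x⊆p y∈)) ps
  ... | no _     | yes refl | _        = Packing-mono (λ y∈ → ∖-mono p-x⊆p (p-x⊆p y∈)) ps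
  ... | no _     | no _     | yes refl = Packing-mono (∖-mono (λ y∈ → p-x⊆p (p-x⊆p y∈))) ps
  -- As the count drops by one, the first path is needed only if `ps` has a further path.
  ... | no a≢x   | no b≢x   | no c≢x   with ps
  ...   | none    = none
  ...   | add _ _ = add (P₃In-avoid p a≢x b≢x c≢x)
                        (subst (Packing _) (delete-first U a b c x) (Packing-∖ x ps))

  OffP₃ : Subset n → Fin n → Set
  OffP₃ U x = ∀ {a b c} → P₃In U a b c → a ≢ x × b ≢ x × c ≢ x

  OffP₃-mono : U ⊆ V → OffP₃ V x → OffP₃ U x
  OffP₃-mono U⊆V off p = off (P₃In-mono U⊆V p)

  Packing-off : OffP₃ U x → Packing k U → Packing k (U ∖ x)
  Packing-off off none = none
  Packing-off {U = U} {x = x} off (add {a = a} {b} {c} p ps) =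
    let a≢x , b≢x , c≢x = off p in
    add (P₃In-avoid p a≢x b≢x c≢x)
        (subst (Packing _) (delete-first U a b c x)
          (Packing-off (OffP₃-mono (λ y∈ → p-x⊆p (p-x⊆p (p-x⊆p y∈))) off) ps))

  copies⇒packing : (cs : Fin k → Copy P₃ G) → (∀ i j → i ≢ j → VertexDisjoint (cs i) (cs j)) →
                   (∀ i t → to (cs i) t ∈ U) → Packing k U
  copies⇒packing {k = zero}  cs disj cs∈ = none
  copies⇒packing {k = suc k} cs disj cs∈ =
    add (p₃ (cs∈ zero zero) (cs∈ zero (suc zero)) (cs∈ zero (suc (suc zero)))
            (preserves (cs zero) (inj₁ refl)) (preserves (cs zero) (inj₁ refl))
            (λ eq → contradiction (injective (cs zero) eq) λ ()))
        (copies⇒packing (λ i → cs (suc i)) (λ i j i≢j → disj (suc i) (suc j) (λ eq → i≢j (suc-injective eq)))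
          (λ i t → x∈p∧x≢y⇒x∈p-y (x∈p∧x≢y⇒x∈p-y (x∈p∧x≢y⇒x∈p-y (cs∈ (suc i) t)
            (disj (suc i) zero (λ ()) t zero)) (disj (suc i) zero (λ ()) t (suc zero)))
            (disj (suc i) zero (λ ()) t (suc (suc zero)))))

  -- How far deletions lower the bound

  -- Passing from U to W divides the bound 2 ^ (∣U∣ / 2 - k / 25) by at least 2 ^ (g / 50).
  Reduces : Subset n → Subset n → ℕ → Set
  Reduces U W g = ∀ {k} → Packing k U →
    ∃ λ k′ → Packing k′ W × 25 * ∣ W ∣ + g + 2 * k ≤ 25 * ∣ U ∣ + 2 * k′

  Reduces-trans : ∀ {g h} → Reduces U V g → Reduces V W h → Reduces U W (g + h)
  Reduces-trans {U} {V} {W} {g} {h} U→V V→W {k} ps =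
    let k₁ , ps₁ , ≤₁ = U→V ps
        k₂ , ps₂ , ≤₂ = V→W ps₁
    in k₂ , ps₂ , +-cancelʳ-≤ (25 * ∣ V ∣ + 2 * k₁) _ _ (begin
      25 * ∣ W ∣ + (g + h) + 2 * k + (25 * ∣ V ∣ + 2 * k₁)
        ≡⟨ reorder₁ (25 * ∣ W ∣) g h (2 * k) (25 * ∣ V ∣) (2 * k₁) ⟩
      (25 * ∣ V ∣ + g + 2 * k) + (25 * ∣ W ∣ + h + 2 * k₁)
        ≤⟨ +-mono-≤ ≤₁ ≤₂ ⟩
      (25 * ∣ U ∣ + 2 * k₁) + (25 * ∣ V ∣ + 2 * k₂)
        ≡⟨ reorder₂ (25 * ∣ U ∣) (2 * k₁) (25 * ∣ V ∣) (2 * k₂) ⟩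
      25 * ∣ U ∣ + 2 * k₂ + (25 * ∣ V ∣ + 2 * k₁) ∎)
    where
    open ≤-Reasoning
    reorder₁ : ∀ w g h k v l → w + (g + h) + k + (v + l) ≡ (v + g + k) + (w + h + l)
    reorder₁ = solve-∀
    reorder₂ : ∀ u l v m → (u + l) + (v + m) ≡ u + m + (v + l)
    reorder₂ = solve-∀

  Reduces-weaken : ∀ {g h} → h ≤ g → Reduces U W g → Reduces U W h
  Reduces-weaken {W = W} h≤g U→W {k} ps =
    let k′ , ps′ , le = U→W ps
    in k′ , ps′ , ≤-trans (+-monoˡ-≤ (2 * k) (+-monoʳ-≤ (25 * ∣ W ∣) h≤g)) le

  25∣U-x∣+25≤25∣U∣ : x ∈ U → 25 * ∣ U ∖ x ∣ + 25 ≤ 25 * ∣ U ∣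
  25∣U-x∣+25≤25∣U∣ {x} {U} x∈U = begin
    25 * ∣ U ∖ x ∣ + 25    ≡⟨ +-comm _ 25 ⟩
    25 + 25 * ∣ U ∖ x ∣    ≡⟨ *-suc 25 ∣ U ∖ x ∣ ⟨
    25 * suc ∣ U ∖ x ∣     ≤⟨ *-monoʳ-≤ 25 (x∈p⇒∣p-x∣<∣p∣ x∈U) ⟩
    25 * ∣ U ∣             ∎
    where open ≤-Reasoning

  -- No path is lost, so the vertex gains its full half in the exponent, 25 fiftieths.
  Reduces-off : x ∈ U → OffP₃ U x → Reduces U (U ∖ x) 25
  Reduces-off x∈U off {k} ps = k , Packing-off off ps , +-monoˡ-≤ (2 * k) (25∣U-x∣+25≤25∣U∣ x∈U)

  -- Of the 25 fiftieths for the vertex, 2 pay for the path that its deletion may destroy.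
  Reduces-∖ : x ∈ U → Reduces U (U ∖ x) 23
  Reduces-∖ {x} {U} x∈U {k} ps = k ∸ 1 , Packing-∖ x ps , (begin
    25 * ∣ U ∖ x ∣ + 23 + 2 * k               ≤⟨ +-monoʳ-≤ (25 * ∣ U ∖ x ∣ + 23) (*-monoʳ-≤ 2 (m≤n+m∸n k 1)) ⟩
    25 * ∣ U ∖ x ∣ + 23 + 2 * (1 + (k ∸ 1))   ≡⟨ reorder (25 * ∣ U ∖ x ∣) (k ∸ 1) ⟩
    25 * ∣ U ∖ x ∣ + 25 + 2 * (k ∸ 1)         ≤⟨ +-monoˡ-≤ (2 * (k ∸ 1)) (25∣U-x∣+25≤25∣U∣ x∈U) ⟩
    25 * ∣ U ∣ + 2 * (k ∸ 1)                  ∎)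
    where
    open ≤-Reasoning
    reorder : ∀ w l → w + 23 + 2 * (1 + l) ≡ w + 25 + 2 * l
    reorder = solve-∀

  Reduces-any : ∀ xs → Reduces U (U ∖* xs) 0
  Reduces-any {U} [] {k} ps = k , ps , ≤-reflexive (cong (_+ 2 * k) (+-identityʳ (25 * ∣ U ∣)))
  Reduces-any {U} (x ∷ xs) with x ∈? U
  ... | yes x∈U = Reduces-weaken z≤n (Reduces-trans (Reduces-∖ x∈U) (Reduces-any xs))
  ... | no  x∉U = Reduces-trans unchanged (Reduces-any xs)
    where
    unchanged : Reduces U (U ∖ x) 0
    unchanged {k} ps = k , Packing-mono (x∉p⇒p⊆p-x x∉U) ps , +-monoˡ-≤ (2 * k)
      (≤-trans (≤-reflexive (+-identityʳ (25 * ∣ U ∖ x ∣))) (*-monoʳ-≤ 25 (p⊆q⇒∣p∣≤∣q∣ (p-x⊆p {p = U} {x}))))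

  Reduces-++ : ∀ {ys} xs → Unique ys → All (_∈ U) ys → Reduces U (U ∖* (ys ++ xs)) (23 * length ys)
  Reduces-++ {ys = []} xs [] [] = Reduces-any xs
  Reduces-++ {ys = y ∷ ys} xs (y∉ys ∷ ys!) (y∈U ∷ ys∈U) =
    subst (Reduces _ _) (sym (*-suc 23 (length ys)))
      (Reduces-trans (Reduces-∖ y∈U) (Reduces-++ xs ys! (All.zipWith keep (y∉ys , ys∈U))))
    where
    keep : ∀ {z} → y ≢ z × z ∈ _ → z ∈ _ ∖ y
    keep (y≢z , z∈U) = x∈p∧x≢y⇒x∈p-y z∈U (λ z≡y → y≢z (sym z≡y))

  -- Only `ys` is counted. The rest of `xs` may contain repetitions or vertices outside `U`, as
  -- further deletions never raise the bound.
  Reduces-∖* : ∀ {xs ys} → Unique ys → All (_∈ U) ys → All (_∈ˡ xs) ys → Reduces U (U ∖* xs) (23 * length ys)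
  Reduces-∖* {U} {xs} {ys} ys! ys∈U ys∈xs =
    subst (λ W → Reduces U W (23 * length ys)) (∖*-absorbˡ (All.lookup ys∈xs)) (Reduces-++ xs ys! ys∈U)

  -- Maximal independent sets and the recursion

  -- `S` may reach outside `U`, so that the same set can be followed while `U` shrinks. Maximality
  -- is phrased as domination.
  record Maximal (U S : Subset n) : Set where
    field
      independent : ∀ {x y} → x ∈ U → y ∈ U → x ∈ S → y ∈ S → ¬ Adj G x y
      dominating  : ∀ {x} → x ∈ U → x ∉ S → ∃ λ y → y ∈ U × y ∈ S × Adj G x y

  open Maximal

  -- The sets containing ins and avoiding outs.  By closedness such a set is determined
  -- by its trace on the residue, where that trace is again maximal.
  record Branch (U : Subset n) : Set where
    field
      ins outs : List (Fin n)

    residue : Subset n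
    residue = U ∖* (ins ++ outs)

    field
      closed   : ∀ {x y} → x ∈ˡ ins → y ∈ U → Adj G x y → y ∈ˡ outs
      shrinks  : ∣ residue ∣ < ∣ U ∣
      gain     : ℕ
      reduces  : Reduces U residue gain
      percent  : ℕ
      positive : NonZero percent
      rate     : 100 ^ 50 ≤ percent ^ 50 * 2 ^ gain

  open Branch

  Follows : Branch U → Subset n → Set
  Follows β S = All (_∈ S) (ins β) × All (_∉ S) (outs β)

  follows? : ∀ (β : Branch U) S → Dec (Follows β S)
  follows? β S = All.all? (_∈? S) (ins β) ×-dec All.all? (λ x → ¬? (x ∈? S)) (outs β)

  -- The dominator of a residual vertex `x` survives: in `ins` it would have put `x` into `outs` by
  -- closedness, and `outs` avoids `S`.
  Maximal-residue : ∀ {S} (β : Branch U) → Follows β S → Maximal U S → Maximal (residue β) S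
  Maximal-residue β (ins∈ , outs∉) M = record
    { independent = λ x∈ y∈ → independent M (proj₁ (∖*⁻ removed x∈)) (proj₁ (∖*⁻ removed y∈))
    ; dominating  = λ x∈ x∉S →
        let x∈U , x∉removed  = ∖*⁻ removed x∈
            y , y∈U , y∈S , x~y = dominating M x∈U x∉S
        in y , ∖*⁺ removed y∈U
             (λ y∈ → [ (λ y∈ins → x∉removed (∈-++⁺ʳ (ins β) (closed β y∈ins x∈U (adj-sym G x~y))))
                     , (λ y∈outs → All.lookup outs∉ y∈outs y∈S) ]′ (∈-++⁻ (ins β) y∈))
           , y∈S , x~y
    }
    where
    removed : List (Fin n)
    removed = ins β ++ outs β

  -- `affordable` makes the shares 2 ^ (-gain / 50) of the branches add up to at most 1.
  record Branching (U : Subset n) : Set where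
    field
      branches : List (Branch U)
      affordable : sum (map percent branches) ≤ 100
      covering   : ∀ {S} → Maximal U S → Any (λ β → Follows β S) branches

  open Branching

  -- By `agree` the members differ only inside `U`, hence at most one is left once `U` is empty.
  record Family (U : Subset n) (L : List (Subset n)) : Set where
    field
      unique  : Unique L
      maximal : ∀ {S} → S ∈ˡ L → Maximal U S
      agree   : ∀ {S S′ x} → S ∈ˡ L → S′ ∈ˡ L → x ∉ U → x ∈ S → x ∈ S′

  open Family

  Family-residue : ∀ {L} (β : Branch U) → Family U L → Family (residue β) (filter (follows? β) L)
  Family-residue {U} {L} β F = record
    { unique  = Unique.filter⁺ (follows? β) (unique F)
    ; maximal = λ S∈ → let S∈L , fol = ∈-filter⁻ (follows? β) {xs = L} S∈ in Maximal-residue β fol (maximal F S∈L)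
    ; agree   = agree′
    }
    where
    agree′ : ∀ {S S′ x} → S ∈ˡ filter (follows? β) L → S′ ∈ˡ filter (follows? β) L →
             x ∉ residue β → x ∈ S → x ∈ S′
    agree′ {S} {S′} {x} S∈ S′∈ x∉ x∈S
      with ∈-filter⁻ (follows? β) {xs = L} S∈ | ∈-filter⁻ (follows? β) {xs = L} S′∈ | x ∈? U | ∈?-list _≟_ x (ins β ++ outs β)
    ... | S∈L , _          | S′∈L , _        | no  x∉U | _       = agree F S∈L S′∈L x∉U x∈S
    ... | _                | _               | yes x∈U | no  x∉′ = contradiction (∖*⁺ (ins β ++ outs β) x∈U x∉′) x∉
    ... | _ , (_ , outs∉)  | _ , (ins∈′ , _) | yes x∈U | yes x∈′ with ∈-++⁻ (ins β) x∈′
    ...   | inj₁ x∈ins  = All.lookup ins∈′ x∈ins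
    ...   | inj₂ x∈outs = contradiction x∈S (All.lookup outs∉ x∈outs)

  Family-∅ : ∀ {L} → Family U L → (∀ x → x ∉ U) → length L ≤ 1
  Family-∅ {L = []}         F empty = z≤n
  Family-∅ {L = _ ∷ []}     F empty = ≤-refl
  Family-∅ {L = S ∷ S′ ∷ L} F empty with unique F
  ... | (S≢S′ ∷ _) ∷ _ = contradiction
    (⊆-antisym (agree F (here refl) (there (here refl)) (empty _)) (agree F (there (here refl)) (here refl) (empty _))) S≢S′

  -- Strong induction on ∣U∣. The claim is the 50th power of length L ≤ 2 ^ (∣U∣ / 2 - k / 25), with
  -- the negative term moved to the left.
  family-bound : (∀ {U v} → v ∈ U → Branching U) → ∀ {L} → Acc _<_ ∣ U ∣ → Packing k U → Family U L →
                 length L ^ 50 * 2 ^ (2 * k) ≤ 2 ^ (25 * ∣ U ∣)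
  family-bound {U} {k} branch {L} (acc rec) ps F with nonempty? U
  ... | yes (v , v∈U) =
    root-sum-≤ 50 100 (branches B) positive rate
      (All.tabulate λ {β} _ → let k′ , ps′ , le = reduces β ps in
        transfer 50 (length (filter (follows? β) L)) (25 * ∣ residue β ∣) (gain β) (2 * k) (25 * ∣ U ∣) (2 * k′)
          (family-bound branch (rec (shrinks β)) ps′ (Family-residue β F)) le)
      (length-cover follows? L (All.tabulate λ S∈L → covering B (maximal F S∈L)))
      (affordable B)
    where
    B : Branching U
    B = branch v∈U
  -- A packing in an empty set has no path, so it is enough that at most one set remains.
  ... | no ¬ne with ps
  ...   | none                   = ≤-trans
    (*-monoˡ-≤ 1 (^-monoˡ-≤ 50 (Family-∅ F (λ x x∈U → ¬ne (x , x∈U))))) (m^n>0 2 (25 * ∣ U ∣))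
  ...   | add (p₃ a∈ _ _ _ _ _) _ = contradiction (_ , a∈) ¬ne

  -- Neighbourhoods and the branches they give

  -- An explicit list lets matching on `ws` read off the degree of `v` in `U` and name its
  -- neighbours.
  record Nbhd (U : Subset n) (v : Fin n) (ws : List (Fin n)) : Set where
    field
      distinct : Unique ws
      inside   : ∀ {w} → w ∈ˡ ws → w ∈ U
      adjacent : ∀ {w} → w ∈ˡ ws → Adj G v w
      complete : ∀ {w} → w ∈ U → Adj G v w → w ∈ˡ ws

  open Nbhd

  nbrs : Subset n → Fin n → List (Fin n)
  nbrs U v = filter (λ w → (w ∈? U) ×-dec adj? G v w) (allFin n)

  nbhd : ∀ U v → Nbhd U v (nbrs U v)
  nbhd U v = record
    { distinct = Unique.filter⁺ nbr? (Unique.allFin⁺ n)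
    ; inside   = λ w∈ → proj₁ (proj₂ (∈-filter⁻ nbr? {xs = allFin n} w∈))
    ; adjacent = λ w∈ → proj₂ (proj₂ (∈-filter⁻ nbr? {xs = allFin n} w∈))
    ; complete = λ w∈U v~w → ∈-filter⁺ nbr? (∈-allFin _) (w∈U , v~w)
    }
    where
    nbr? : ∀ w → Dec (w ∈ U × Adj G v w)
    nbr? w = (w ∈? U) ×-dec adj? G v w

  private variable
    S : Subset n
    u w : Fin n
    vs ws es : List (Fin n)

  adj⇒≢ : Adj G v w → v ≢ w
  adj⇒≢ v~w refl = adj-irr G v~w

  excluded : Maximal U S → v ∈ U → v ∈ S → Nbhd U v ws → All (_∉ S) ws
  excluded M v∈U v∈S N = All.tabulate λ w∈ w∈S → independent M v∈U (inside N w∈) v∈S w∈S (adjacent N w∈)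

  included : Maximal U S → v ∈ U → v ∉ S → Nbhd U v ws → Any (_∈ S) ws
  included M v∈U v∉S N =
    let w , w∈U , w∈S , v~w = dominating M v∈U v∉S
    in lose (complete N w∈U v~w) w∈S

  -- The price depends on a lower bound `r` for the number of deleted vertices, since often only a
  -- lower bound on a degree is known. A positive `r` makes the residue shrink.
  branch : ∀ (ins outs ys : List (Fin n)) → (∀ {x y} → x ∈ˡ ins → y ∈ U → Adj G x y → y ∈ˡ outs) →
           Unique ys → All (_∈ U) ys → All (_∈ˡ (ins ++ outs)) ys →
           ∀ r .{{_ : NonZero r}} → r ≤ length ys → Branch U
  branch ins outs [] closed ys! ys∈U ys∈ (suc r) ()
  branch {U} ins outs ys@(y ∷ _) closed ys! ys∈U@(y∈U ∷ _) ys∈@(y∈ ∷ _) r r≤ = record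
    { ins      = ins
    ; outs     = outs
    ; closed   = closed
    ; shrinks  = p⊂q⇒∣p∣<∣q∣
        ((λ z∈ → proj₁ (∖*⁻ (ins ++ outs) z∈)) , y , y∈U , (λ y∈′ → proj₂ (∖*⁻ (ins ++ outs) y∈′) y∈))
    ; gain     = 23 * r
    ; reduces  = Reduces-weaken (*-monoʳ-≤ 23 r≤) (Reduces-∖* ys! ys∈U ys∈)
    ; percent  = price r
    ; positive = proj₁ (price-rate r)
    ; rate     = proj₂ (price-rate r)
    }

  -- `w` is chosen while `es` is known to be avoided. Being no neighbours of `w`, the vertices of
  -- `es` are extra deletions.
  star : ∀ es w → w ∈ U → Nbhd U w ws → Unique es → All (λ e → e ∈ U × w ≢ e × ¬ Adj G w e) es →
         ∀ r .{{_ : NonZero r}} → r ≤ suc (length es + length ws) → Branch U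
  star {U} {ws} es w w∈U N es! apart r r≤ = branch (w ∷ []) (es ++ ws) (w ∷ es ++ ws)
    (λ { (here refl) y∈U w~y → ∈-++⁺ʳ es (complete N y∈U w~y) })
    (AllP.++⁺ (All.map (λ (_ , w≢e , _) → w≢e) apart) (All.tabulate λ x∈ → adj⇒≢ (adjacent N x∈))
      ∷ Unique.++⁺ es! (distinct N) λ (x∈es , x∈ws) → proj₂ (proj₂ (All.lookup apart x∈es)) (adjacent N x∈ws))
    (w∈U ∷ AllP.++⁺ (All.map proj₁ apart) (All.tabulate (inside N)))
    (All.tabulate λ x∈ → x∈)
    r (≤-trans r≤ (≤-reflexive (cong suc (sym (length-++ es)))))

  follows-star : Maximal U S → w ∈ U → Nbhd U w ws → w ∈ S → All (_∉ S) es →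
                 All (_∈ S) (w ∷ []) × All (_∉ S) (es ++ ws)
  follows-star M w∈U N w∈S es∉S = w∈S ∷ [] , AllP.++⁺ es∉S (excluded M w∈U w∈S N)

  -- Degrees 0, 1 and at least 4

  isolated : v ∈ U → Nbhd U v [] → Branching U
  isolated {v} {U} v∈U N = record
    { branches   = record
        { ins      = v ∷ []
        ; outs     = []
        ; closed   = λ { (here refl) → complete N }
        ; shrinks  = x∈p⇒∣p-x∣<∣p∣ v∈U
        ; gain     = 25
        ; reduces  = Reduces-off v∈U off
        -- Rounded up from 2 ^ (-1/2), about 0.7071.
        ; percent  = 71
        ; positive = _
        ; rate     = ≤ᵇ⇒≤ _ _ _
        } ∷ []
    ; affordable = ≤ᵇ⇒≤ _ _ _
    ; covering   = cover
    }
    where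
    off : OffP₃ U v
    off (p₃ a∈ b∈ c∈ a~b b~c _) =
      (λ { refl → case complete N b∈ a~b of λ () }) ,
      (λ { refl → case complete N c∈ b~c of λ () }) ,
      (λ { refl → case complete N b∈ (adj-sym G b~c) of λ () })

    cover : Maximal U S → Any _ _
    cover {S} M with v ∈? S
    ... | yes v∈S = here (v∈S ∷ [] , [])
    ... | no  v∉S = case included M v∈U v∉S N of λ ()

  -- With `v` as an end, the middle is `u` and the other end is `v` again. With `v` as the middle,
  -- both ends are `u`.
  edge-off : Nbhd U v (u ∷ []) → Nbhd U u (v ∷ []) → OffP₃ U v
  edge-off {U} {v} {u} Nv Nu {a} {b} {c} (p₃ a∈ b∈ c∈ a~b b~c a≢c) =
    (λ { refl → a≢c (sym (end c∈ b∈ a~b b~c)) }) ,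
    (λ { refl → a≢c (trans (other a∈ (adj-sym G a~b)) (sym (other c∈ b~c))) }) ,
    (λ { refl → a≢c (end a∈ b∈ (adj-sym G b~c) (adj-sym G a~b)) })
    where
    other : ∀ {x} → x ∈ U → Adj G v x → x ≡ u
    other x∈ v~x with complete Nv x∈ v~x
    ... | here x≡u = x≡u

    end : ∀ {x y} → y ∈ U → x ∈ U → Adj G v x → Adj G x y → y ≡ v
    end y∈ x∈ v~x x~y with other x∈ v~x
    ... | refl with complete Nu y∈ x~y
    ...   | here y≡v = y≡v

  edge-branch : v ∈ U → Nbhd U v (u ∷ []) → Nbhd U u (v ∷ []) → Branch U
  edge-branch {v} {U} {u} v∈U Nv Nu = record
    { ins      = v ∷ []
    ; outs     = u ∷ []
    ; closed   = λ { (here refl) → complete Nv }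
    ; shrinks  = ≤-<-trans (p⊆q⇒∣p∣≤∣q∣ (p-x⊆p {p = U ∖ v} {u})) (x∈p⇒∣p-x∣<∣p∣ v∈U)
    ; gain     = 50
    ; reduces  = Reduces-trans (Reduces-off v∈U (edge-off Nv Nu))
                   (Reduces-off (x∈p∧x≢y⇒x∈p-y (inside Nv (here refl)) (λ u≡v → adj⇒≢ (adjacent Nv (here refl)) (sym u≡v)))
                     (OffP₃-mono p-x⊆p (edge-off Nu Nv)))
    -- Exactly 2 ^ (-50/50), so the two branches on the edge use up the whole budget.
    ; percent  = 50
    ; positive = _
    ; rate     = ≤ᵇ⇒≤ _ _ _
    }

  isolated-edge : v ∈ U → Nbhd U v (u ∷ []) → Nbhd U u (v ∷ []) → Branching U
  isolated-edge {v} {U} {u} v∈U Nv Nu = record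
    { branches   = edge-branch v∈U Nv Nu ∷ edge-branch u∈U Nu Nv ∷ []
    ; affordable = ≤ᵇ⇒≤ _ _ _
    ; covering   = cover
    }
    where
    u∈U : u ∈ U
    u∈U = inside Nv (here refl)

    cover : Maximal U S → Any _ _
    cover {S} M with v ∈? S
    ... | yes v∈S = here (v∈S ∷ [] , excluded M v∈U v∈S Nv)
    ... | no  v∉S with included M v∈U v∉S Nv
    ...   | here u∈S = there (here (u∈S ∷ [] , v∉S ∷ []))

  -- Choosing `v` deletes at least 5 vertices, avoiding it deletes one: 21 + 73 = 94 percent.
  high-degree : ∀ {w₁ w₂ w₃ w₄} → v ∈ U → Nbhd U v (w₁ ∷ w₂ ∷ w₃ ∷ w₄ ∷ ws) → Branching U
  high-degree {v} {U} v∈U N = record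
    { branches   = star [] v v∈U N [] [] 5 (m≤m+n 5 _)
                 ∷ branch [] (v ∷ []) (v ∷ []) (λ ()) ([] ∷ []) (v∈U ∷ []) (here refl ∷ []) 1 ≤-refl
                 ∷ []
    ; affordable = ≤ᵇ⇒≤ _ _ _
    ; covering   = cover
    }
    where
    cover : Maximal U S → Any _ _
    cover {S} M with v ∈? S
    ... | yes v∈S = here (follows-star M v∈U N v∈S [])
    ... | no  v∉S = there (here ([] , v∉S ∷ []))

  -- Either `v` or `u` is chosen, deleting 2 or at least 3 vertices: 53 + 39 = 92 percent.
  leaf : v ∈ U → Nbhd U v (u ∷ []) → Nbhd U u ws → 2 ≤ length ws → Branching U
  leaf {v} {U} {u} v∈U Nv Nu 2≤ = record
    { branches   = star [] v v∈U Nv [] [] 2 ≤-refl ∷ star [] u u∈U Nu [] [] 3 (s≤s 2≤) ∷ []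
    ; affordable = ≤ᵇ⇒≤ _ _ _
    ; covering   = cover
    }
    where
    u∈U : u ∈ U
    u∈U = inside Nv (here refl)

    cover : Maximal U S → Any _ _
    cover {S} M with v ∈? S
    ... | yes v∈S = here (follows-star M v∈U Nv v∈S [])
    ... | no  v∉S with included M v∈U v∉S Nv
    ...   | here u∈S = there (here (follows-star M u∈U Nu u∈S []))

  -- Degrees 2 and 3 in a triangle-free graph

  module _ (tf : TriangleFree G) where

    -- Neighbours of a common vertex are not adjacent, so those avoided earlier qualify as the extra
    -- deletions of `star`.
    apart : Nbhd U v vs → w ∈ˡ vs → All (_∈ˡ vs) es → All (w ≢_) es →
            All (λ e → e ∈ U × w ≢ e × ¬ Adj G w e) es
    apart N w∈ es⊆ w≢es = All.zipWith
      (λ (e∈ , w≢e) → inside N e∈ , w≢e , λ w~e → tf (adjacent N w∈) w~e (adjacent N e∈))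
      (es⊆ , w≢es)

    degree-2 : ∀ {w₁ w₂ ws₁ ws₂} → v ∈ U → Nbhd U v (w₁ ∷ w₂ ∷ []) → Nbhd U w₁ ws₁ → Nbhd U w₂ ws₂ →
               ∀ r₁ r₂ .{{_ : NonZero r₁}} .{{_ : NonZero r₂}} →
               r₁ ≤ suc (length ws₁) → r₂ ≤ 2 + length ws₂ →
               price 3 + (price r₁ + (price r₂ + 0)) ≤ 100 → Branching U
    degree-2 {v} {U} {w₁} {w₂} v∈U N N₁ N₂ r₁ r₂ r₁≤ r₂≤ price≤ with distinct N
    ... | (w₁≢w₂ ∷ []) ∷ _ = record
      { branches   = star [] v v∈U N [] [] 3 ≤-refl
                   ∷ star [] w₁ w₁∈U N₁ [] [] r₁ r₁≤
                   ∷ star (w₁ ∷ []) w₂ w₂∈U N₂ ([] ∷ [])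
                       (apart N (there (here refl)) (here refl ∷ []) (≢-sym w₁≢w₂ ∷ [])) r₂ r₂≤
                   ∷ []
      ; affordable = price≤
      ; covering   = cover
      }
      where
      w₁∈U : w₁ ∈ U
      w₁∈U = inside N (here refl)

      w₂∈U : w₂ ∈ U
      w₂∈U = inside N (there (here refl))

      cover : Maximal U S → Any _ _
      cover {S} M with v ∈? S | w₁ ∈? S
      ... | yes v∈S | _        = here (follows-star M v∈U N v∈S [])
      ... | no _    | yes w₁∈S = there (here (follows-star M w₁∈U N₁ w₁∈S []))
      ... | no v∉S  | no w₁∉S  with included M v∈U v∉S N
      ...   | here w₁∈S         = contradiction w₁∈S w₁∉S
      ...   | there (here w₂∈S) = there (there (here (follows-star M w₂∈U N₂ w₂∈S (w₁∉S ∷ []))))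

    -- Each neighbour already avoided is one more deletion, so the four branches cost 28 + 28 + 21 +
    -- 15 = 92 percent.
    degree-3 : ∀ {w₁ w₂ w₃ ws₁ ws₂ ws₃} → v ∈ U → Nbhd U v (w₁ ∷ w₂ ∷ w₃ ∷ []) →
               Nbhd U w₁ ws₁ → Nbhd U w₂ ws₂ → Nbhd U w₃ ws₃ →
               3 ≤ length ws₁ → 3 ≤ length ws₂ → 3 ≤ length ws₃ → Branching U
    degree-3 {v} {U} {w₁} {w₂} {w₃} v∈U N N₁ N₂ N₃ 3≤₁ 3≤₂ 3≤₃ with distinct N
    ... | (w₁≢w₂ ∷ w₁≢w₃ ∷ []) ∷ (w₂≢w₃ ∷ []) ∷ _ = record
      { branches   = star [] v v∈U N [] [] 4 ≤-refl
                   ∷ star [] w₁ w₁∈U N₁ [] [] 4 (s≤s 3≤₁)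
                   ∷ star (w₁ ∷ []) w₂ w₂∈U N₂ ([] ∷ [])
                       (apart N (there (here refl)) (here refl ∷ []) (≢-sym w₁≢w₂ ∷ [])) 5 (s≤s (s≤s 3≤₂))
                   ∷ star (w₁ ∷ w₂ ∷ []) w₃ w₃∈U N₃ ((w₁≢w₂ ∷ []) ∷ [] ∷ [])
                       (apart N (there (there (here refl))) (here refl ∷ there (here refl) ∷ [])
                         (≢-sym w₁≢w₃ ∷ ≢-sym w₂≢w₃ ∷ [])) 6 (s≤s (s≤s (s≤s 3≤₃)))
                   ∷ []
      ; affordable = ≤ᵇ⇒≤ _ _ _
      ; covering   = cover
      }
      where
      w₁∈U : w₁ ∈ U
      w₁∈U = inside N (here refl)

      w₂∈U : w₂ ∈ U
      w₂∈U = inside N (there (here refl))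

      w₃∈U : w₃ ∈ U
      w₃∈U = inside N (there (there (here refl)))

      cover : Maximal U S → Any _ _
      cover {S} M with v ∈? S | w₁ ∈? S | w₂ ∈? S
      ... | yes v∈S | _        | _        = here (follows-star M v∈U N v∈S [])
      ... | no _    | yes w₁∈S | _        = there (here (follows-star M w₁∈U N₁ w₁∈S []))
      ... | no _    | no w₁∉S  | yes w₂∈S = there (there (here (follows-star M w₂∈U N₂ w₂∈S (w₁∉S ∷ []))))
      ... | no v∉S  | no w₁∉S  | no w₂∉S  with included M v∈U v∉S N
      ...   | here w₁∈S                 = contradiction w₁∈S w₁∉S
      ...   | there (here w₂∈S)         = contradiction w₂∈S w₂∉S
      ...   | there (there (here w₃∈S)) =
        there (there (there (here (follows-star M w₃∈U N₃ w₃∈S (w₁∉S ∷ w₂∉S ∷ [])))))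

    -- Equal neighbourhoods put `w₁` and `w₂` into the set together, so avoiding `v` deletes four
    -- vertices: 39 + 28 = 67 percent.
    twins : ∀ {w₁ w₂} → v ∈ U → Nbhd U v (w₁ ∷ w₂ ∷ []) →
            Nbhd U w₁ (v ∷ a ∷ []) → Nbhd U w₂ (v ∷ a ∷ []) → Branching U
    twins {v} {U} {a} {w₁} {w₂} v∈U N N₁ N₂ with distinct N | distinct N₁
    ... | (w₁≢w₂ ∷ []) ∷ _ | (v≢a ∷ []) ∷ _ = record
      { branches   = star [] v v∈U N [] [] 3 ≤-refl
                   ∷ branch (w₁ ∷ w₂ ∷ []) (v ∷ a ∷ []) (w₁ ∷ w₂ ∷ v ∷ a ∷ [])
                       (λ { (here refl) → complete N₁ ; (there (here refl)) → complete N₂ })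
                       ((w₁≢w₂ ∷ adj⇒≢ (adjacent N₁ (here refl)) ∷ adj⇒≢ (adjacent N₁ (there (here refl))) ∷ [])
                         ∷ (adj⇒≢ (adjacent N₂ (here refl)) ∷ adj⇒≢ (adjacent N₂ (there (here refl))) ∷ [])
                         ∷ (v≢a ∷ []) ∷ [] ∷ [])
                       (w₁∈U ∷ w₂∈U ∷ v∈U ∷ inside N₁ (there (here refl)) ∷ [])
                       (All.tabulate λ x∈ → x∈)
                       4 ≤-refl
                   ∷ []
      ; affordable = ≤ᵇ⇒≤ _ _ _
      ; covering   = cover
      }
      where
      w₁∈U : w₁ ∈ U
      w₁∈U = inside N (here refl)

      w₂∈U : w₂ ∈ U
      w₂∈U = inside N (there (here refl))

      twin∈ : ∀ {x y} → Maximal U S → x ∈ U → y ∈ U → Nbhd U x (v ∷ a ∷ []) → Nbhd U y (v ∷ a ∷ []) →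
              x ∈ S → y ∈ S
      twin∈ {S} {y = y} M x∈U y∈U Nx Ny x∈S with y ∈? S
      ... | yes y∈S = y∈S
      ... | no  y∉S = contradiction (included M y∈U y∉S Ny) (AllP.All¬⇒¬Any (excluded M x∈U x∈S Nx))

      cover : Maximal U S → Any _ _
      cover {S} M with v ∈? S
      ... | yes v∈S = here (follows-star M v∈U N v∈S [])
      ... | no  v∉S with included M v∈U v∉S N
      ...   | here w₁∈S         =
        there (here (w₁∈S ∷ twin∈ M w₁∈U w₂∈U N₁ N₂ w₁∈S ∷ [] , excluded M w₁∈U w₁∈S N₁))
      ...   | there (here w₂∈S) =
        there (here (twin∈ M w₂∈U w₁∈U N₂ N₁ w₂∈S ∷ w₂∈S ∷ [] , excluded M w₂∈U w₂∈S N₂))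

    -- If `v` and `w₁` are avoided, only `w₂` can dominate `v` and only `a` can dominate `w₁`. The
    -- cost is 39 + 39 + 21 = 99 percent.
    path : ∀ {w₁ w₂} → v ∈ U → Nbhd U v (w₁ ∷ w₂ ∷ []) →
           Nbhd U w₁ (v ∷ a ∷ []) → Nbhd U w₂ (v ∷ b ∷ []) → a ≢ b → Branching U
    path {v} {U} {a} {b} {w₁} {w₂} v∈U N N₁ N₂ a≢b with distinct N | distinct N₁ | distinct N₂
    ... | (w₁≢w₂ ∷ []) ∷ _ | (v≢a ∷ []) ∷ _ | (v≢b ∷ []) ∷ _ = record
      { branches   = star [] v v∈U N [] [] 3 ≤-refl
                   ∷ star [] w₁ w₁∈U N₁ [] [] 3 ≤-refl
                   -- `nbrs U a` is there for closedness and repeats `w₁`; only the five distinct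
                   -- vertices listed last are counted.
                   ∷ branch (w₂ ∷ a ∷ []) (v ∷ w₁ ∷ b ∷ nbrs U a) (w₂ ∷ a ∷ v ∷ w₁ ∷ b ∷ [])
                       closes
                       ((≢-sym a≢w₂ ∷ ≢-sym (adj⇒≢ v~w₂) ∷ ≢-sym w₁≢w₂ ∷ adj⇒≢ w₂~b ∷ [])
                         ∷ (≢-sym v≢a ∷ ≢-sym (adj⇒≢ w₁~a) ∷ a≢b ∷ [])
                         ∷ (adj⇒≢ v~w₁ ∷ v≢b ∷ [])
                         ∷ (≢-sym b≢w₁ ∷ [])
                         ∷ [] ∷ [])
                       (w₂∈U ∷ a∈U ∷ v∈U ∷ w₁∈U ∷ inside N₂ (there (here refl)) ∷ [])
                       (here refl ∷ there (here refl) ∷ there (there (here refl)) ∷ there (there (there (here refl)))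
                         ∷ there (there (there (there (here refl)))) ∷ [])
                       5 ≤-refl
                   ∷ []
      ; affordable = ≤ᵇ⇒≤ _ _ _
      ; covering   = cover
      }
      where
      w₁∈U : w₁ ∈ U
      w₁∈U = inside N (here refl)

      w₂∈U : w₂ ∈ U
      w₂∈U = inside N (there (here refl))

      a∈U : a ∈ U
      a∈U = inside N₁ (there (here refl))

      v~w₁ : Adj G v w₁
      v~w₁ = adjacent N (here refl)

      v~w₂ : Adj G v w₂
      v~w₂ = adjacent N (there (here refl))

      w₁~a : Adj G w₁ a
      w₁~a = adjacent N₁ (there (here refl))

      w₂~b : Adj G w₂ b
      w₂~b = adjacent N₂ (there (here refl))

      a≢w₂ : a ≢ w₂
      a≢w₂ refl = tf v~w₁ w₁~a v~w₂

      b≢w₁ : b ≢ w₁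
      b≢w₁ refl = tf v~w₂ w₂~b v~w₁

      closes : ∀ {x y} → x ∈ˡ (w₂ ∷ a ∷ []) → y ∈ U → Adj G x y → y ∈ˡ (v ∷ w₁ ∷ b ∷ nbrs U a)
      closes (here refl) y∈U w₂~y with complete N₂ y∈U w₂~y
      ... | here y≡v         = here y≡v
      ... | there (here y≡b) = there (there (here y≡b))
      closes (there (here refl)) y∈U a~y = there (there (there (complete (nbhd U a) y∈U a~y)))

      cover : Maximal U S → Any _ _
      cover {S} M with v ∈? S | w₁ ∈? S
      ... | yes v∈S | _        = here (follows-star M v∈U N v∈S [])
      ... | no _    | yes w₁∈S = there (here (follows-star M w₁∈U N₁ w₁∈S []))
      ... | no v∉S  | no w₁∉S  with included M v∈U v∉S N | included M w₁∈U w₁∉S N₁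
      ...   | here w₁∈S         | _                = contradiction w₁∈S w₁∉S
      ...   | there (here _)    | here v∈S         = contradiction v∈S v∉S
      ...   | there (here w₂∈S) | there (here a∈S) with excluded M w₂∈U w₂∈S N₂
      ...     | _ ∷ b∉S ∷ [] =
        there (there (here (w₂∈S ∷ a∈S ∷ [] , v∉S ∷ w₁∉S ∷ b∉S ∷ excluded M a∈U a∈S (nbhd U a))))

    -- Choosing a vertex of minimum degree

    other-nbr : Nbhd U w ws → length ws ≡ 2 → v ∈ˡ ws → ∃ λ a → Nbhd U w (v ∷ a ∷ [])
    other-nbr {ws = _ ∷ a ∷ []} N refl (here refl)         = a , N
    other-nbr {ws = a ∷ v ∷ []} N refl (there (here refl)) = a , record
      { distinct = case distinct N of λ { ((a≢v ∷ []) ∷ _) → (≢-sym a≢v ∷ []) ∷ [] ∷ [] }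
      ; inside   = λ x∈ → inside N (flip x∈)
      ; adjacent = λ x∈ → adjacent N (flip x∈)
      ; complete = λ x∈U w~x → flip (complete N x∈U w~x)
      }
      where
      flip : ∀ {x y z : Fin n} → x ∈ˡ (y ∷ z ∷ []) → x ∈ˡ (z ∷ y ∷ [])
      flip (here x≡y)         = there (here x≡y)
      flip (there (here x≡z)) = here x≡z

    branch-at-minimum : v ∈ U → Nbhd U v ws → (∀ {w} → w ∈ U → length ws ≤ length (nbrs U w)) →
                        Branching U
    branch-at-minimum {ws = []} v∈U N least = isolated v∈U N
    branch-at-minimum {U = U} {ws = u ∷ []} v∈U N least
      with nbrs U u | nbhd U u | complete (nbhd U u) v∈U (adj-sym G (adjacent N (here refl)))
    ... | _ ∷ []    | Nu | here refl = isolated-edge v∈U N Nu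
    ... | _ ∷ _ ∷ _ | Nu | _         = leaf v∈U N Nu (s≤s (s≤s z≤n))
    branch-at-minimum {v = v} {U = U} {ws = w₁ ∷ w₂ ∷ []} v∈U N least =
      by-degrees (3 ≤? length (nbrs U w₁)) (3 ≤? length (nbrs U w₂))
      where
      2≤deg : ∀ {w} → w ∈ˡ (w₁ ∷ w₂ ∷ []) → 2 ≤ length (nbrs U w)
      2≤deg w∈ = least (inside N w∈)

      -- With minimum degree 2, a degree below 3 is exactly 2.
      beyond : ∀ {w} → w ∈ˡ (w₁ ∷ w₂ ∷ []) → ¬ 3 ≤ length (nbrs U w) → ∃ λ a → Nbhd U w (v ∷ a ∷ [])
      beyond w∈ deg≱3 = other-nbr (nbhd U _) (≤-antisym (≤-pred (≰⇒> deg≱3)) (2≤deg w∈))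
        (complete (nbhd U _) v∈U (adj-sym G (adjacent N w∈)))

      by-degrees : Dec (3 ≤ length (nbrs U w₁)) → Dec (3 ≤ length (nbrs U w₂)) → Branching U
      -- Degree at least 3 at `w₁` costs 39 + 28 + 28 = 95 percent; at `w₂` alone, 39 + 39 + 21 =
      -- 99.
      by-degrees (yes 3≤) _ = degree-2 v∈U N (nbhd U w₁) (nbhd U w₂) 4 4
        (s≤s 3≤) (s≤s (s≤s (2≤deg (there (here refl))))) (≤ᵇ⇒≤ _ _ _)
      by-degrees (no _) (yes 3≤) = degree-2 v∈U N (nbhd U w₁) (nbhd U w₂) 3 5
        (s≤s (2≤deg (here refl))) (s≤s (s≤s 3≤)) (≤ᵇ⇒≤ _ _ _)
      by-degrees (no ≱3₁) (no ≱3₂) with beyond (here refl) ≱3₁ | beyond (there (here refl)) ≱3₂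
      ... | a , N₁ | b , N₂ with a ≟ b
      ...   | yes refl = twins v∈U N N₁ N₂
      ...   | no  a≢b  = path v∈U N N₁ N₂ a≢b
    branch-at-minimum {U = U} {ws = w₁ ∷ w₂ ∷ w₃ ∷ []} v∈U N least =
      degree-3 v∈U N (nbhd U w₁) (nbhd U w₂) (nbhd U w₃)
        (least (inside N (here refl))) (least (inside N (there (here refl))))
        (least (inside N (there (there (here refl)))))
    branch-at-minimum {ws = _ ∷ _ ∷ _ ∷ _ ∷ _} v∈U N least = high-degree v∈U N

    branching : v ∈ U → Branching U
    branching {v} {U} v∈U = branch-at-minimum
      -- The default value `v` of `argmin` lies in `U` as well.
      (argmin-all deg v∈U (AllP.all-filter (_∈? U) (allFin n))) (nbhd U _)
      (λ w∈U → All.lookup (f[argmin]≤f[xs] v vertices) (∈-filter⁺ (_∈? U) (∈-allFin _) w∈U))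
      where
      deg : Fin n → ℕ
      deg w = length (nbrs U w)

      vertices : List (Fin n)
      vertices = filter (_∈? U) (allFin n)

  -- The whole graph

  -- A vertex outside `S` with no neighbour in `S` could be added to `S`.
  maximalIndependent⇒maximal : MaximalIndependent G S → Maximal ⊤ S
  maximalIndependent⇒maximal {S} (ind , max) = record
    { independent = λ _ _ → ind _ _
    ; dominating  = dominated
    }
    where
    dominated : ∀ {x} → x ∈ ⊤ → x ∉ S → ∃ λ y → y ∈ ⊤ × y ∈ S × Adj G x y
    dominated {x} _ x∉S with any? (λ y → (y ∈? S) ×-dec adj? G x y)
    ... | yes (y , y∈S , x~y) = y , ∈⊤ , y∈S , x~y
    ... | no undominated      = contradiction
      (max (S ∪ ⁅ x ⁆) extended (p⊆p∪q ⁅ x ⁆) (q⊆p∪q S ⁅ x ⁆ (x∈⁅x⁆ x))) x∉S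
      where
      extended : Independent G (S ∪ ⁅ x ⁆)
      extended u w u∈ w∈ u~w with x∈p∪q⁻ S ⁅ x ⁆ u∈ | x∈p∪q⁻ S ⁅ x ⁆ w∈
      ... | inj₁ u∈S | inj₁ w∈S = ind u w u∈S w∈S u~w
      ... | inj₁ u∈S | inj₂ w∈x with x∈⁅y⁆⇒x≡y x w∈x
      ...   | refl = undominated (u , u∈S , adj-sym G u~w)
      extended u w u∈ w∈ u~w | inj₂ u∈x | inj₁ w∈S with x∈⁅y⁆⇒x≡y x u∈x
      ...   | refl = undominated (w , w∈S , u~w)
      extended u w u∈ w∈ u~w | inj₂ u∈x | inj₂ w∈x with x∈⁅y⁆⇒x≡y x u∈x | x∈⁅y⁆⇒x≡y x w∈x
      ...   | refl | refl = adj-irr G u~w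

  MIS-bound : TriangleFree G → ContainsDisjoint k P₃ G → MIS G ^ 50 * 2 ^ (2 * k) ≤ 2 ^ (25 * n)
  MIS-bound {k} tf (cs , disj) =
    subst (λ m → MIS G ^ 50 * 2 ^ (2 * k) ≤ 2 ^ (25 * m)) (∣⊤∣≡n n)
      (family-bound (branching tf) (<-wellFounded _) (copies⇒packing cs disj (λ _ _ → ∈⊤)) record
        { unique  = Unique.filter⁺ (maximalIndependent? G) (subsets! n)
        ; maximal = λ S∈ → maximalIndependent⇒maximal (proj₂ (∈-filter⁻ (maximalIndependent? G) {xs = subsets n} S∈))
        ; agree   = λ _ _ x∉⊤ → contradiction ∈⊤ x∉⊤
        })

-- The rational exponent

open import Data.Integer using (+_; _⊖_) renaming (_+_ to _+ℤ_; _*_ to _*ℤ_; -_ to -ℤ_)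
open import Data.Integer.Properties using (⊖-≥; ⊖-≰; pos-*; neg-distribˡ-*; m-n≡m⊖n)
open import Data.Rational.Unnormalised using (mkℚᵘ; _/_; _-_)

≤2^-intro : ∀ m a b → m ^ 50 * 2 ^ b ≤ 2 ^ a → m ≤2^ mkℚᵘ (a ⊖ b) 49
≤2^-intro m a b le with b ≤? a
... | yes b≤a rewrite ⊖-≥ b≤a = *-cancelʳ-≤ _ _ (2 ^ b) {{m^n≢0 2 b}} (begin
  m ^ 50 * 2 ^ b        ≤⟨ le ⟩
  2 ^ a                 ≡⟨ cong (2 ^_) (m∸n+n≡m b≤a) ⟨
  2 ^ (a ∸ b + b)       ≡⟨ ^-distribˡ-+-* 2 (a ∸ b) b ⟩
  2 ^ (a ∸ b) * 2 ^ b   ∎)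
  where open ≤-Reasoning
-- The exponent is negative here, and b ∸ a in the form `suc d` matches the encoding `-[1+ d ]`.
... | no b≰a with b ∸ a in b∸a | ⊖-≰ b≰a
...   | zero  | _ = contradiction (m∸n≡0⇒m≤n b∸a) b≰a
...   | suc d | eq rewrite eq = *-cancelʳ-≤ _ _ (2 ^ a) {{m^n≢0 2 a}} (begin
  m ^ 50 * 2 ^ suc d * 2 ^ a     ≡⟨ *-assoc (m ^ 50) (2 ^ suc d) (2 ^ a) ⟩
  m ^ 50 * (2 ^ suc d * 2 ^ a)   ≡⟨ cong (m ^ 50 *_) (^-distribˡ-+-* 2 (suc d) a) ⟨
  m ^ 50 * 2 ^ (suc d + a)       ≡⟨ cong (λ c → m ^ 50 * 2 ^ (c + a)) b∸a ⟨
  m ^ 50 * 2 ^ (b ∸ a + a)       ≡⟨ cong (λ c → m ^ 50 * 2 ^ c) (m∸n+n≡m (≰⇒≥ b≰a)) ⟩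
  m ^ 50 * 2 ^ b                 ≤⟨ le ⟩
  2 ^ a                          ≡⟨ *-identityˡ (2 ^ a) ⟨
  1 * 2 ^ a                      ∎)
  where open ≤-Reasoning

-- Unnormalised subtraction multiplies the denominators to 50, stored as 49.
exponent : ∀ n k → (+ n / 2 - + k / 25) ≡ mkℚᵘ (25 * n ⊖ 2 * k) 49
exponent n k = cong (λ i → mkℚᵘ i 49) (begin
  + n *ℤ + 25 +ℤ -ℤ (+ k) *ℤ + 2     ≡⟨ cong₂ _+ℤ_ (pos-* n 25) (neg-distribˡ-* (+ k) (+ 2)) ⟨
  + (n * 25) +ℤ -ℤ (+ k *ℤ + 2)      ≡⟨ cong (λ i → + (n * 25) +ℤ -ℤ i) (pos-* k 2) ⟨
  + (n * 25) +ℤ -ℤ (+ (k * 2))       ≡⟨ m-n≡m⊖n (n * 25) (k * 2) ⟩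
  n * 25 ⊖ k * 2                     ≡⟨ cong₂ _⊖_ (*-comm n 25) (*-comm k 2) ⟩
  25 * n ⊖ 2 * k                     ∎)
  where open ≡-Reasoning

lemma2p4 : ∀ (n k : ℕ) (G : Graph n) → TriangleFree G →
    ContainsDisjoint k P₃ G →
    MIS G ≤2^ (+ n / 2 - + k / 25)
lemma2p4 n k G tf c = subst (MIS G ≤2^_) (sym (exponent n k))
  (≤2^-intro (MIS G) (25 * n) (2 * k) (Bound.MIS-bound G tf c))
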